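{- Let $w\in S_n$ be $k$-Grassmannian and let $P_w\in\mathcal{P}_{k,n}$ be the lattice path with $(P_w)_U=w([k])=\{w(1),\dots,w(k)\}$. Let $\mathbf{x_w}$ be a reduced word for $x_w$ and $\mathbf w$ a reduced word for $w$. Then $x_ww=\tau_{P_w}$, and the concatenation $\mathbf{x_w}\mathbf w$ is a reduced word for $\tau_{P_w}$, of length $k(n-k)$.
   Context: Let $n\ge2$, $0\le k\le n$. $\tilde S_n$ is the group of bijections $f:\mathbb{Z}\to\mathbb{Z}$ with $f(i+n)=f(i)+n$, with products read left to right, $(fg)(a)=g(f(a))$. $\tilde S_n^{(k)}$ is the subset with $\frac1n\sum_{i=1}^n(f(i)-i)=k$. Length: $\ell(f)=\#\{(a,b):1\le a\le n,\ b\in\mathbb{Z},\ a<b,\ f(a)>f(b)\}$. $s_i$ ($0\le i\le n-1$) exchanges $i+mn$ and $i+1+mn$ for all $m$ and fixes all other integers. $\Lambda(i)=i+1$. $S_n\subset\tilde S_n$ via periodic extension. A reduced word for $f\in\tilde S_n^{(k)}$ is a sequence $(s_{i_1},\dots,s_{i_m})$ with $s_{i_1}\cdots s_{i_m}=\Lambda^{ -k}f$ and $m=\ell(f)$ (for $w\in S_n$ this is with $k=0$, the usual notion). A permutation $w\in S_n$ is $k$-Grassmannian if $w(1)<\dots<w(k)$ and $w(k+1)<\dots<w(n)$. $\tau_{k,n}\in\tilde S_n^{(k)}$ is given by $\tau_{k,n}(i)=i+n$ for $1\le i\le k$ and $\tau_{k,n}(i)=i$ for $k+1\le i\le n$; $x_w:=w^{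 -1}\tau_{k,n}$. $\mathcal{P}_{k,n}$ is the set of lattice paths from $(0,0)$ to $(n-k,k)$ with $n$ unit right/up steps; $P_U\subset[n]$ is the set of indices of the up-steps of $P$. $\tau_P\in\tilde S_n^{(k)}$ is the affine permutation with $\tau_P(i)=i+n$ if $i\bmod n\in P_U$ and $\tau_P(i)=i$ otherwise (residues taken in $[n]$). -}

module Defs where

open import Data.Bool.Base using (Bool; true; false; if_then_else_)
open import Data.Fin.Base as Fin using (Fin; toℕ; fromℕ<)
import Data.Fin.Properties as Fin
open import Data.Fin.Permutation
  using (Permutation′; _⟨$⟩ʳ_; _⟨$⟩ˡ_; inverseʳ; inverseˡ; flip)
open import Data.Fin.Subset using (Subset; _∈_; inside; outside)
open import Data.Fin.Subset.Properties using (⊆-antisym)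
open import Data.Integer.Base as ℤ using (ℤ; +_; +[1+_]; 0ℤ; 1ℤ; -1ℤ; _+_; _-_; _*_; -_; _%ℕ_; _/ℕ_)
open import Data.Integer.DivMod using (n%ℕd<d; a≡a%ℕn+[a/ℕn]*n)
import Data.Integer.Properties as ℤ
open import Data.Integer.Tactic.RingSolver using (solve)
open import Data.List.Base as List using (List; []; _∷_; foldr; length)
open import Data.Nat.Base as ℕ using (ℕ; zero; suc; NonZero; NonTrivial; nonTrivial⇒nonZero)
import Data.Nat.Properties as ℕ
open import Data.Product.Base using (Σ-syntax; ∃-syntax; _×_; _,_; proj₁; proj₂)
open import Data.Rational.Base as ℚ using (ℚ; fromℚᵘ)
open import Data.Rational.Properties using (fromℚᵘ-cong)
open import Data.Rational.Unnormalised.Base using (mkℚᵘ; *≡*)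
open import Data.Vec.Base as Vec using (Vec; []; _∷_; lookup; tabulate)
open import Data.Vec.Properties using (lookup∘tabulate; []=⇒lookup; lookup⇒[]=)
open import Function.Base using (_∘_; case_of_)
open import Function.Bundles using (_↔_; _⇔_; Inverse; Equivalence; mk↔ₛ′; mk⇔)
open import Relation.Binary.Definitions using (tri<; tri≈; tri>)
open import Relation.Binary.PropositionalEquality
  using (_≡_; _≢_; refl; sym; trans; cong; cong₂; subst; subst₂; module ≡-Reasoning)
open import Relation.Nullary using (yes; no; contradiction; ¬_)

open import Algebra.Bundles using (AbelianGroup)
import Algebra.Properties.Group (AbelianGroup.group ℤ.+-0-abelianGroup) as ℤ+
import Algebra.Properties.CommutativeMonoid.Sum ℤ.+-0-commutativeMonoid as ∑ℤ
import Algebra.Properties.CommutativeMonoid.Sum ℕ.+-0-commutativeMonoid as ∑ℕ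

private
  instance
    nonTrivial→nonZero : ∀ {n} → .{{NonTrivial n}} → NonZero n
    nonTrivial→nonZero {n} = nonTrivial⇒nonZero n

  variable
    n k : ℕ

-- The set [n] = {1,…,n} is represented by Fin n, with i : Fin n standing
-- for the integer label i = i + 1.

label : Fin n → ℤ
label i = + suc (toℕ i)

-- a = label (residue a) + quotient a * n

residue : .{{NonTrivial n}} → ℤ → Fin n
residue {n} a = fromℕ< (n%ℕd<d (a - 1ℤ) n)

quotient : .{{NonTrivial n}} → ℤ → ℤ
quotient {n} a = (a - 1ℤ) /ℕ n

private
  split-< : ∀ n {r r′ q q′} → r ℕ.< n → q ℤ.< q′ →
            + r + q * + n ℤ.< + r′ + q′ * + n
  split-< n {r} {r′} {q} {q′} r<n q<q′ = begin-strict
    + r + q * + n    <⟨ ℤ.+-monoˡ-< (q * + n) (ℤ.+<+ r<n) ⟩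
    + n + q * + n    ≡⟨ sym (ℤ.suc-* q (+ n)) ⟩
    ℤ.suc q * + n    ≤⟨ ℤ.*-monoʳ-≤-nonNeg (+ n) (ℤ.i<j⇒suc[i]≤j q<q′) ⟩
    q′ * + n         ≤⟨ ℤ.i≤j+i _ (+ r′) ⟩
    + r′ + q′ * + n  ∎
    where open ℤ.≤-Reasoning

  split-unique : ∀ n {r r′ q q′} → r ℕ.< n → r′ ℕ.< n →
                 + r + q * + n ≡ + r′ + q′ * + n → r ≡ r′ × q ≡ q′
  split-unique n {r} {r′} {q} {q′} r<n r′<n eq with ℤ.<-cmp q q′
  ... | tri< q<q′ _ _ = contradiction eq (ℤ.<⇒≢ (split-< n {r} {r′} r<n q<q′))
  ... | tri> _ _ q′<q = contradiction (sym eq) (ℤ.<⇒≢ (split-< n {r′} {r} r′<n q′<q))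
  ... | tri≈ _ refl _ = ℤ.+-injective (ℤ+.∙-cancelʳ (q * + n) (+ r) (+ r′) eq) , refl
label-residue : .{{_ : NonTrivial n}} (a : ℤ) →
                label (residue a) + quotient a * + n ≡ a
label-residue {n} a = begin
  + suc (toℕ (residue a)) + q * + n        ≡⟨ cong (λ r → + suc r + q * + n) (Fin.toℕ-fromℕ< _) ⟩
  1ℤ + + r + q * + n                       ≡⟨ ℤ.+-assoc 1ℤ (+ r) (q * + n) ⟩
  1ℤ + (+ r + q * + n)                     ≡⟨ cong (ℤ._+_ 1ℤ) (sym (a≡a%ℕn+[a/ℕn]*n (a - 1ℤ) n)) ⟩
  1ℤ + (a - 1ℤ)                            ≡⟨ solve (a List.∷ List.[]) ⟩
  a                                        ∎
  where
  open ≡-Reasoning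
  q = quotient a
  r = (a - 1ℤ) %ℕ n

residue-quotient : .{{_ : NonTrivial n}} (i : Fin n) (q : ℤ) →
  residue (label i + q * + n) ≡ i × quotient (label i + q * + n) ≡ q
residue-quotient {n} i q = Fin.toℕ-injective (proj₁ u) , proj₂ u
  where
  a = label i + q * + n
  eq : + toℕ (residue a) + quotient a * + n ≡ + toℕ i + q * + n
  eq = ℤ+.∙-cancelˡ 1ℤ _ _ (begin
    1ℤ + (+ toℕ (residue a) + quotient a * + n)  ≡⟨ sym (ℤ.+-assoc 1ℤ (+ toℕ (residue a)) (quotient a * + n)) ⟩
    label (residue a) + quotient a * + n         ≡⟨ label-residue a ⟩
    label i + q * + n                            ≡⟨ ℤ.+-assoc 1ℤ (+ toℕ i) (q * + n) ⟩
    1ℤ + (+ toℕ i + q * + n)                     ∎)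
    where open ≡-Reasoning
  u = split-unique n {q = quotient a} (Fin.toℕ<n (residue a)) (Fin.toℕ<n i) eq

residue-label : .{{_ : NonTrivial n}} (i : Fin n) → residue (label i) ≡ i
residue-label {n} i =
  trans (cong residue (sym (ℤ.+-identityʳ (label i)))) (proj₁ (residue-quotient i 0ℤ))

quotient-label : .{{_ : NonTrivial n}} (i : Fin n) → quotient {n} (label i) ≡ 0ℤ
quotient-label {n} i =
  trans (cong (quotient {n}) (sym (ℤ.+-identityʳ (label i)))) (proj₂ (residue-quotient i 0ℤ))

private
  +n-split : .{{_ : NonTrivial n}} (a : ℤ) →
             a + + n ≡ label (residue a) + (quotient {n} a + 1ℤ) * + n
  +n-split {n} a = begin
    a + + n                                  ≡⟨ cong (λ t → t + + n) (sym (label-residue a)) ⟩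
    label (residue a) + quotient a * + n + + n
      ≡⟨ arith (label (residue a)) (quotient {n} a) (+ n) ⟩
    label (residue a) + (quotient {n} a + 1ℤ) * + n ∎
    where
    open ≡-Reasoning
    arith : ∀ r q m → r + q * m + m ≡ r + (q + 1ℤ) * m
    arith r q m = solve (r List.∷ q List.∷ m List.∷ List.[])

residue-+n : .{{_ : NonTrivial n}} (a : ℤ) → residue {n} (a + + n) ≡ residue a
residue-+n {n} a = trans (cong residue (+n-split a))
  (proj₁ (residue-quotient (residue a) (quotient {n} a + 1ℤ)))

quotient-+n : .{{_ : NonTrivial n}} (a : ℤ) → quotient {n} (a + + n) ≡ quotient {n} a + 1ℤ
quotient-+n {n} a = trans (cong (quotient {n}) (+n-split a))
  (proj₂ (residue-quotient (residue a) (quotient {n} a + 1ℤ)))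

residue--n : .{{_ : NonTrivial n}} (a : ℤ) → residue {n} (a - + n) ≡ residue a
residue--n {n} a = trans (sym (residue-+n (a - + n))) (cong residue (arith a (+ n)))
  where
  arith : ∀ a m → a - m + m ≡ a
  arith a m = solve (a List.∷ m List.∷ List.[])

record AffinePerm (n : ℕ) : Set where
  field
    bijection : ℤ ↔ ℤ
  open Inverse bijection public using (to; from; strictlyInverseˡ; strictlyInverseʳ)
  field
    periodic : ∀ i → to (i + + n) ≡ to i + + n

open AffinePerm public using (to; from)

infix 4 _≈_
_≈_ : AffinePerm n → AffinePerm n → Set
f ≈ g = ∀ i → to f i ≡ to g i

ε : AffinePerm n
ε = record { bijection = mk↔ₛ′ (λ i → i) (λ i → i) (λ _ → refl) (λ _ → refl)
           ; periodic = λ _ → refl }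

-- Products are read left to right.

infixl 7 _·_
_·_ : AffinePerm n → AffinePerm n → AffinePerm n
f · g = record
  { bijection = mk↔ₛ′ (λ a → to g (to f a)) (λ a → from f (from g a))
      (λ a → trans (cong (to g) (F.strictlyInverseˡ _)) (G.strictlyInverseˡ a))
      (λ a → trans (cong (from f) (G.strictlyInverseʳ _)) (F.strictlyInverseʳ a))
  ; periodic = λ a → trans (cong (to g) (F.periodic a)) (G.periodic _)
  }
  where
  module F = AffinePerm f
  module G = AffinePerm g

infix 8 _⁻¹
_⁻¹ : AffinePerm n → AffinePerm n
_⁻¹ {n} f = record
  { bijection = mk↔ₛ′ (from f) (to f) F.strictlyInverseʳ F.strictlyInverseˡ
  ; periodic = λ a → begin
      from f (a + + n)               ≡⟨ cong (λ b → from f (b + + n)) (sym (F.strictlyInverseˡ a)) ⟩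
      from f (to f (from f a) + + n) ≡⟨ cong (from f) (sym (F.periodic (from f a))) ⟩
      from f (to f (from f a + + n)) ≡⟨ F.strictlyInverseʳ _ ⟩
      from f a + + n                 ∎
  }
  where
  open ≡-Reasoning
  module F = AffinePerm f

infixr 8 _^_
_^_ : AffinePerm n → ℕ → AffinePerm n
f ^ zero  = ε
f ^ suc m = f · f ^ m

Λ : AffinePerm n
Λ {n} = record
  { bijection = mk↔ₛ′ (_+ 1ℤ) (_- 1ℤ)
      (λ a → solve (a List.∷ List.[])) (λ a → solve (a List.∷ List.[]))
  ; periodic = λ a → arith a (+ n)
  }
  where
  arith : ∀ a m → a + m + 1ℤ ≡ a + 1ℤ + m
  arith a m = solve (a List.∷ m List.∷ List.[])

averageDisplacement : .{{NonTrivial n}} → AffinePerm n → ℚ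
averageDisplacement {n} f = ∑ℤ.sum (λ (i : Fin n) → to f (label i) - label i) ℚ./ n

-- The component of the affine permutations of average displacement k.

record S̃ (n k : ℕ) .{{_ : NonTrivial n}} : Set where
  field
    perm    : AffinePerm n
    average : averageDisplacement perm ≡ + k ℚ./ 1

open S̃ public using (perm)

-- In sᵢ the index i : Fin n stands for the integer i itself
-- (0 ≤ i ≤ n - 1), not for label i.

module _ {n : ℕ} .{{_ : NonTrivial n}} where

  -- Residues of a and a - 1 are compared with i, so a ≡ i ↦ a + 1 and
  -- a ≡ i + 1 ↦ a - 1 modulo n.

  swap : Fin n → ℤ → ℤ
  swap i a with a %ℕ n ℕ.≟ toℕ i
  ... | yes _ = a + 1ℤ
  ... | no  _ with (a - 1ℤ) %ℕ n ℕ.≟ toℕ i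
  ...   | yes _ = a - 1ℤ
  ...   | no  _ = a

  private
    %-+n : ∀ a → (a + + n) %ℕ n ≡ a %ℕ n
    %-+n a = proj₁ (split-unique n {q = (a + + n) /ℕ n} {q′ = a /ℕ n + 1ℤ} (n%ℕd<d (a + + n) n) (n%ℕd<d a n) (begin
      + ((a + + n) %ℕ n) + ((a + + n) /ℕ n) * + n ≡⟨ sym (a≡a%ℕn+[a/ℕn]*n (a + + n) n) ⟩
      a + + n                                     ≡⟨ cong (λ t → t + + n) (a≡a%ℕn+[a/ℕn]*n a n) ⟩
      + (a %ℕ n) + (a /ℕ n) * + n + + n           ≡⟨ arith (+ (a %ℕ n)) (a /ℕ n) (+ n) ⟩
      + (a %ℕ n) + (a /ℕ n + 1ℤ) * + n            ∎))
      where
      open ≡-Reasoning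
      arith : ∀ r q m → r + q * m + m ≡ r + (q + 1ℤ) * m
      arith r q m = solve (r List.∷ q List.∷ m List.∷ List.[])

    -- Two consecutive integers are incongruent modulo n, as n ≥ 2.
    %-+1 : ∀ a → (a + 1ℤ) %ℕ n ≢ a %ℕ n
    %-+1 a eq = case proj₁ (split-unique n {r = 1} {r′ = 0} {q = 0ℤ} {q′ = q′ - q}
                       (ℕ.nonTrivial⇒n>1 n) (ℕ.>-nonZero⁻¹ n) one) of λ ()
      where
      q  = a /ℕ n
      q′ = (a + 1ℤ) /ℕ n
      r  = + (a %ℕ n)
      e₁ : a + 1ℤ ≡ r + q′ * + n
      e₁ = trans (a≡a%ℕn+[a/ℕn]*n (a + 1ℤ) n) (cong (λ t → + t + q′ * + n) eq)
      arith₁ : ∀ a → 1ℤ ≡ a + 1ℤ - a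
      arith₁ a = solve (a List.∷ List.[])
      arith₂ : ∀ r q q′ m → r + q′ * m - (r + q * m) ≡ 0ℤ + (q′ - q) * m
      arith₂ r q q′ m = solve (r List.∷ q List.∷ q′ List.∷ m List.∷ List.[])
      one : 1ℤ + 0ℤ * + n ≡ 0ℤ + (q′ - q) * + n
      one = begin
        1ℤ + 0ℤ * + n                    ≡⟨ arith₁ a ⟩
        a + 1ℤ - a                       ≡⟨ cong₂ _-_ e₁ (a≡a%ℕn+[a/ℕn]*n a n) ⟩
        r + q′ * + n - (r + q * + n)     ≡⟨ arith₂ r q q′ (+ n) ⟩
        0ℤ + (q′ - q) * + n              ∎
        where open ≡-Reasoning

    +1-1 : ∀ a → a + 1ℤ - 1ℤ ≡ a
    +1-1 a = solve (a List.∷ List.[])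

    -1+1 : ∀ a → a - 1ℤ + 1ℤ ≡ a
    -1+1 a = solve (a List.∷ List.[])

    swap-fst : ∀ i a → a %ℕ n ≡ toℕ i → swap i a ≡ a + 1ℤ
    swap-fst i a p with a %ℕ n ℕ.≟ toℕ i
    ... | yes _ = refl
    ... | no ¬p = contradiction p ¬p

    swap-snd : ∀ i a → (a - 1ℤ) %ℕ n ≡ toℕ i → swap i a ≡ a - 1ℤ
    swap-snd i a p with a %ℕ n ℕ.≟ toℕ i
    ... | yes q = contradiction
                    (trans (cong (_%ℕ n) (-1+1 a)) (trans q (sym p))) (%-+1 (a - 1ℤ))
    ... | no  _ with (a - 1ℤ) %ℕ n ℕ.≟ toℕ i
    ...   | yes _ = refl
    ...   | no ¬p = contradiction p ¬p

    swap-other : ∀ i a → a %ℕ n ≢ toℕ i → (a - 1ℤ) %ℕ n ≢ toℕ i → swap i a ≡ a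
    swap-other i a ¬p ¬q with a %ℕ n ℕ.≟ toℕ i
    ... | yes p = contradiction p ¬p
    ... | no  _ with (a - 1ℤ) %ℕ n ℕ.≟ toℕ i
    ...   | yes q = contradiction q ¬q
    ...   | no  _ = refl

    swap-involutive : ∀ i a → swap i (swap i a) ≡ a
    swap-involutive i a with a %ℕ n ℕ.≟ toℕ i
    ... | yes p = trans (swap-snd i (a + 1ℤ) (trans (cong (_%ℕ n) (+1-1 a)) p)) (+1-1 a)
    ... | no ¬p with (a - 1ℤ) %ℕ n ℕ.≟ toℕ i
    ...   | yes q = trans (swap-fst i (a - 1ℤ) q) (-1+1 a)
    ...   | no ¬q = swap-other i a ¬p ¬q

    +n-1 : ∀ a m → a + m - 1ℤ ≡ a - 1ℤ + m
    +n-1 a m = solve (a List.∷ m List.∷ List.[])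

    +n+1 : ∀ a m → a + m + 1ℤ ≡ a + 1ℤ + m
    +n+1 a m = solve (a List.∷ m List.∷ List.[])

    %-+n-1 : ∀ a → (a + + n - 1ℤ) %ℕ n ≡ (a - 1ℤ) %ℕ n
    %-+n-1 a = trans (cong (_%ℕ n) (+n-1 a (+ n))) (%-+n (a - 1ℤ))

    swap-periodic : ∀ i a → swap i (a + + n) ≡ swap i a + + n
    swap-periodic i a with a %ℕ n ℕ.≟ toℕ i
    ... | yes p = trans (swap-fst i (a + + n) (trans (%-+n a) p)) (+n+1 a (+ n))
    ... | no ¬p with (a - 1ℤ) %ℕ n ℕ.≟ toℕ i
    ...   | yes q = trans (swap-snd i (a + + n) (trans (%-+n-1 a) q)) (+n-1 a (+ n))
    ...   | no ¬q = swap-other i (a + + n) (¬p ∘ trans (sym (%-+n a))) (¬q ∘ trans (sym (%-+n-1 a)))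

  s : Fin n → AffinePerm n
  s i = record
    { bijection = mk↔ₛ′ (swap i) (swap i) (swap-involutive i) (swap-involutive i)
    ; periodic  = swap-periodic i
    }

  wordProduct : List (Fin n) → AffinePerm n
  wordProduct = foldr (λ i f → s i · f) ε

Inversion : AffinePerm n → Set
Inversion {n} f =
  Σ[ (a , b) ∈ ℤ × ℤ ] (1ℤ ℤ.≤ a × a ℤ.≤ + n) × a ℤ.< b × to f a ℤ.> to f b

-- ℓ(f) = m. The inversions are pairs of integers together with proofs of
-- order relations on ℤ, which are propositions, so this counts pairs.

HasLength : AffinePerm n → ℕ → Set
HasLength f m = Fin m ↔ Inversion f

IsReducedWord : .{{_ : NonTrivial n}} → S̃ n k → List (Fin n) → Set
IsReducedWord {k = k} f 𝐰 =
  wordProduct 𝐰 ≈ (Λ ⁻¹) ^ k · perm f × HasLength (perm f) (length 𝐰)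

private
  ∑-neg : ∀ {n} (g h : Fin n → ℤ) →
          ∑ℤ.sum (λ i → g i - h i) ≡ ∑ℤ.sum g - ∑ℤ.sum h
  ∑-neg {zero}  g h = refl
  ∑-neg {suc n} g h = trans
    (cong (ℤ._+_ (g Fin.zero - h Fin.zero)) (∑-neg (g ∘ Fin.suc) (h ∘ Fin.suc)))
    (arith (g Fin.zero) (h Fin.zero) (∑ℤ.sum (g ∘ Fin.suc)) (∑ℤ.sum (h ∘ Fin.suc)))
    where
    arith : ∀ a b c d → a - b + (c - d) ≡ a + c - (b + d)
    arith a b c d = solve (a List.∷ b List.∷ c List.∷ d List.∷ List.[])

  ∑-displacement : ∀ (w : Permutation′ n) (h : Fin n → ℤ) →
    ∑ℤ.sum (λ i → h (w ⟨$⟩ʳ i) - label i) ≡ ∑ℤ.sum (λ i → h i - label i)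
  ∑-displacement {n} w h = begin
    ∑ℤ.sum (λ i → h (w ⟨$⟩ʳ i) - label i)   ≡⟨ ∑-neg (h ∘ (w ⟨$⟩ʳ_)) label ⟩
    ∑ℤ.sum (h ∘ (w ⟨$⟩ʳ_)) - ∑ℤ.sum (label {n})   ≡⟨ cong (_- ∑ℤ.sum (label {n})) (sym (∑ℤ.sum-permute h w)) ⟩
    ∑ℤ.sum h - ∑ℤ.sum (label {n})                 ≡⟨ sym (∑-neg h label) ⟩
    ∑ℤ.sum (λ i → h i - label i)            ∎
    where open ≡-Reasoning

  average-≡ : ∀ n .{{_ : NonZero n}} {i} k → i ≡ + k * + n → i ℚ./ n ≡ + k ℚ./ 1
  average-≡ n@(suc m) {i} k eq = fromℚᵘ-cong {mkℚᵘ i m} {mkℚᵘ (+ k) 0}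
    (*≡* (trans (ℤ.*-identityʳ i) eq))

  count : ∀ {n} → (Fin n → Bool) → ℕ
  count p = ∑ℕ.sum (λ i → if p i then 1 else 0)

  ∑-if : ∀ m {n} (p : Fin n → Bool) →
         ∑ℤ.sum (λ i → if p i then + m else 0ℤ) ≡ + count p * + m
  ∑-if m {zero}  p = sym (ℤ.*-zeroˡ (+ m))
  ∑-if m {suc n} p with p Fin.zero
  ... | true  = trans (cong (ℤ._+_ (+ m)) (∑-if m (p ∘ Fin.suc)))
                      (sym (ℤ.suc-* (+ count (p ∘ Fin.suc)) (+ m)))
  ... | false = trans (ℤ.+-identityˡ _) (∑-if m (p ∘ Fin.suc))

  count-< : k ℕ.≤ n → count {n} (λ i → toℕ i ℕ.<ᵇ k) ≡ k
  count-< {n = zero}  ℕ.z≤n       = refl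
  count-< {n = suc n} ℕ.z≤n       = count-< {n = n} ℕ.z≤n
  count-< {n = suc n} (ℕ.s≤s k≤n) = cong suc (count-< k≤n)

module _ {n : ℕ} .{{_ : NonTrivial n}} where

  extend : Permutation′ n → ℤ → ℤ
  extend w a = label (w ⟨$⟩ʳ residue a) + quotient {n} a * + n

  private
    extend-inverse : ∀ (v w : Permutation′ n) → (∀ i → v ⟨$⟩ʳ (w ⟨$⟩ʳ i) ≡ i) →
                     ∀ a → extend v (extend w a) ≡ a
    extend-inverse v w eq a = begin
      extend v (extend w a)                                    ≡⟨⟩
      label (v ⟨$⟩ʳ residue b) + quotient {n} b * + n
        ≡⟨ cong₂ (λ i q → label (v ⟨$⟩ʳ i) + q * + n) (proj₁ rq) (proj₂ rq) ⟩
      label (v ⟨$⟩ʳ (w ⟨$⟩ʳ residue a)) + quotient {n} a * + n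
        ≡⟨ cong (λ i → label i + quotient {n} a * + n) (eq (residue a)) ⟩
      label (residue a) + quotient {n} a * + n                 ≡⟨ label-residue a ⟩
      a                                                        ∎
      where
      open ≡-Reasoning
      b = extend w a
      rq = residue-quotient (w ⟨$⟩ʳ residue a) (quotient {n} a)

    extend-periodic : ∀ w a → extend w (a + + n) ≡ extend w a + + n
    extend-periodic w a = trans
      (cong₂ (λ i q → label (w ⟨$⟩ʳ i) + q * + n) (residue-+n a) (quotient-+n a))
      (arith (label (w ⟨$⟩ʳ residue a)) (quotient {n} a) (+ n))
      where
      arith : ∀ r q m → r + (q + 1ℤ) * m ≡ r + q * m + m
      arith r q m = solve (r List.∷ q List.∷ m List.∷ List.[])

    extend-label : ∀ w i → extend w (label i) ≡ label (w ⟨$⟩ʳ i)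
    extend-label w i = trans
      (cong₂ (λ j q → label (w ⟨$⟩ʳ j) + q * + n) (residue-label i) (quotient-label i))
      (ℤ.+-identityʳ _)

  affine : Permutation′ n → AffinePerm n
  affine w = record
    { bijection = mk↔ₛ′ (extend w) (extend (flip w))
        (extend-inverse w (flip w) (λ _ → inverseʳ w))
        (extend-inverse (flip w) w (λ _ → inverseˡ w))
    ; periodic = extend-periodic w
    }

  finite : Permutation′ n → S̃ n 0
  finite w = record
    { perm    = affine w
    ; average = average-≡ n 0 (begin
        ∑ℤ.sum (λ (i : Fin n) → extend w (label i) - label i)
          ≡⟨ ∑ℤ.sum-cong-≗ (λ i → cong (ℤ._- label i) (extend-label w i)) ⟩
        ∑ℤ.sum (λ i → label (w ⟨$⟩ʳ i) - label i)  ≡⟨ ∑-displacement w label ⟩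
        ∑ℤ.sum (λ (i : Fin n) → label i - label i)
          ≡⟨ ∑ℤ.sum-cong-≗ (λ (i : Fin n) → ℤ.+-inverseʳ (label i)) ⟩
        ∑ℤ.sum (λ (i : Fin n) → 0ℤ)                ≡⟨ ∑ℤ.sum-replicate-zero n ⟩
        0ℤ                                         ≡⟨ sym (ℤ.*-zeroˡ (+ n)) ⟩
        0ℤ * + n                                   ∎)
    }
    where open ≡-Reasoning

  private
    shift : (Fin n → Bool) → ℤ → ℤ
    shift p a = if p (residue a) then a + + n else a

    unshift : (Fin n → Bool) → ℤ → ℤ
    unshift p a = if p (residue a) then a - + n else a

    +n-n : ∀ a m → a + m - m ≡ a
    +n-n a m = solve (a List.∷ m List.∷ List.[])

    -n+n : ∀ a m → a - m + m ≡ a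
    -n+n a m = solve (a List.∷ m List.∷ List.[])

    shift-unshift : ∀ p a → shift p (unshift p a) ≡ a
    shift-unshift p a with p (residue a) in eq
    ... | true  rewrite residue--n {n} a | eq = -n+n a (+ n)
    ... | false rewrite eq = refl

    unshift-shift : ∀ p a → unshift p (shift p a) ≡ a
    unshift-shift p a with p (residue a) in eq
    ... | true  rewrite residue-+n {n} a | eq = +n-n a (+ n)
    ... | false rewrite eq = refl

    shift-periodic : ∀ p a → shift p (a + + n) ≡ shift p a + + n
    shift-periodic p a rewrite residue-+n {n} a with p (residue a)
    ... | true  = refl
    ... | false = refl

  -- The affine permutation adding n to the integers a whose residue in [n]
  -- satisfies p, and fixing the others.

  translation : (Fin n → Bool) → AffinePerm n
  translation p = record
    { bijection = mk↔ₛ′ (λ a → if p (residue a) then a + + n else a) (unshift p)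
                        (shift-unshift p) (unshift-shift p)
    ; periodic  = shift-periodic p
    }

  private
    shift-label : ∀ p i → shift p (label i) ≡ label i + (if p i then + n else 0ℤ)
    shift-label p i rewrite residue-label i with p i
    ... | true  = refl
    ... | false = sym (ℤ.+-identityʳ _)

    ∑-shift : ∀ p → ∑ℤ.sum (λ (i : Fin n) → shift p (label i) - label i) ≡ + count p * + n
    ∑-shift p = trans
      (∑ℤ.sum-cong-≗ (λ i → trans (cong (_- label i) (shift-label p i))
                                  (arith (label i) (if p i then + n else 0ℤ))))
      (∑-if n p)
      where
      arith : ∀ a c → a + c - a ≡ c
      arith a c = solve (a List.∷ c List.∷ List.[])

  translation-average : ∀ p k → count p ≡ k →
                        averageDisplacement (translation p) ≡ + k ℚ./ 1
  translation-average p k refl = average-≡ n k (∑-shift p)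

  -- τ_{k,n}, translating the integers with residue in {1,…,k}.

  τ[_] : k ℕ.≤ n → S̃ n k
  τ[_] {k = k} k≤n = record
    { perm    = translation (λ i → toℕ i ℕ.<ᵇ k)
    ; average = translation-average _ k (count-< k≤n)
    }

  x : k ℕ.≤ n → Permutation′ n → S̃ n k
  x {k = k} k≤n w = record
    { perm    = affine w ⁻¹ · perm τ[ k≤n ]
    ; average = average-≡ n k (begin
        ∑ℤ.sum (λ (i : Fin n) → shift p (extend (flip w) (label i)) - label i)
          ≡⟨ ∑ℤ.sum-cong-≗ (λ i → cong (λ a → shift p a - label i) (extend-label (flip w) i)) ⟩
        ∑ℤ.sum (λ (i : Fin n) → shift p (label (w ⟨$⟩ˡ i)) - label i)
          ≡⟨ ∑-displacement (flip w) (shift p ∘ label) ⟩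
        ∑ℤ.sum (λ (i : Fin n) → shift p (label i) - label i)   ≡⟨ ∑-shift p ⟩
        + count p * + n                              ≡⟨ cong (λ c → + c * + n) (count-< k≤n) ⟩
        + k * + n                                    ∎)
    }
    where
    open ≡-Reasoning
    p : Fin n → Bool
    p i = toℕ i ℕ.<ᵇ k

-- Since Fin n starts at 0, position i + 1 of [n] is at most k exactly when
-- toℕ i < k.

IsGrassmannian : ℕ → Permutation′ n → Set
IsGrassmannian {n} k w =
    (∀ (i j : Fin n) → i Fin.< j → toℕ j ℕ.< k → w ⟨$⟩ʳ i Fin.< w ⟨$⟩ʳ j)
  × (∀ (i j : Fin n) → i Fin.< j → k ℕ.≤ toℕ i → w ⟨$⟩ʳ i Fin.< w ⟨$⟩ʳ j)

data Step : Set where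
  right up : Step

endpoint : Vec Step n → ℕ × ℕ
endpoint []           = 0 , 0
endpoint (right ∷ ss) = let (h , v) = endpoint ss in suc h , v
endpoint (up    ∷ ss) = let (h , v) = endpoint ss in h , suc v

record LatticePath (n k : ℕ) : Set where
  field
    steps    : Vec Step n
    endpoint≡ : endpoint steps ≡ (n ℕ.∸ k , k)

open LatticePath public using (steps)

isUp : Step → Bool
isUp right = outside
isUp up    = inside

upSteps : LatticePath n k → Subset n
upSteps P = Vec.map isUp (steps P)

private
  count-up : (ss : Vec Step n) → count (lookup (Vec.map isUp ss)) ≡ proj₂ (endpoint ss)
  count-up []           = refl
  count-up (right ∷ ss) = count-up ss
  count-up (up    ∷ ss) = cong suc (count-up ss)

τ : .{{_ : NonTrivial n}} → LatticePath n k → S̃ n k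
τ {k = k} P = record
  { perm    = translation (lookup (upSteps P))
  ; average = translation-average _ k
                (trans (count-up (steps P)) (cong proj₂ (LatticePath.endpoint≡ P)))
  }

-- The set of indices of up-steps is w([k]).

UpStepsAreImage : Permutation′ n → LatticePath n k → Set
UpStepsAreImage {n} {k} w P =
  ∀ (j : Fin n) → j ∈ upSteps P ⇔ (∃[ i ] toℕ i ℕ.< k × w ⟨$⟩ʳ i ≡ j)

private
  fromBool : Bool → Step
  fromBool true  = up
  fromBool false = right

  isUp-fromBool : ∀ b → isUp (fromBool b) ≡ b
  isUp-fromBool true  = refl
  isUp-fromBool false = refl

  fromBool-isUp : ∀ t → fromBool (isUp t) ≡ t
  fromBool-isUp right = refl
  fromBool-isUp up    = refl

  endpoint-sum : (ss : Vec Step n) → proj₁ (endpoint ss) ℕ.+ proj₂ (endpoint ss) ≡ n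
  endpoint-sum []           = refl
  endpoint-sum (right ∷ ss) = cong suc (endpoint-sum ss)
  endpoint-sum (up    ∷ ss) = trans (ℕ.+-suc _ _) (cong suc (endpoint-sum ss))

  lookup-up : (p : Fin n → Bool) (j : Fin n) →
              lookup (Vec.map isUp (tabulate (fromBool ∘ p))) j ≡ p j
  lookup-up {suc n} p Fin.zero    = isUp-fromBool _
  lookup-up {suc n} p (Fin.suc j) = lookup-up (p ∘ Fin.suc) j

  up-determined : (ss ts : Vec Step n) → Vec.map isUp ss ≡ Vec.map isUp ts → ss ≡ ts
  up-determined []       []       _  = refl
  up-determined (s ∷ ss) (t ∷ ts) eq = cong₂ _∷_
    (trans (sym (fromBool-isUp s)) (trans (cong fromBool (cong Vec.head eq)) (fromBool-isUp t)))
    (up-determined ss ts (cong Vec.tail eq))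

-- For each w there is exactly one such path (path, path-upSteps, path-unique).

path : k ℕ.≤ n → Permutation′ n → LatticePath n k
path {k} {n} k≤n w = record
  { steps     = ss
  ; endpoint≡ = cong₂ _,_
      (trans (sym (ℕ.m+n∸n≡m (proj₁ (endpoint ss)) (proj₂ (endpoint ss)))) (cong₂ ℕ._∸_ (endpoint-sum ss) ups)) ups
  }
  where
  p : Fin n → Bool
  p j = toℕ (w ⟨$⟩ˡ j) ℕ.<ᵇ k
  ss = tabulate (fromBool ∘ p)
  ups : proj₂ (endpoint ss) ≡ k
  ups = begin
    proj₂ (endpoint ss)                  ≡⟨ sym (count-up ss) ⟩
    count (lookup (Vec.map isUp ss))
      ≡⟨ ∑ℕ.sum-cong-≗ (λ j → cong (if_then 1 else 0) (lookup-up p j)) ⟩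
    count p
      ≡⟨ sym (∑ℕ.sum-permute (λ i → if toℕ i ℕ.<ᵇ k then 1 else 0) (flip w)) ⟩
    count {n} (λ i → toℕ i ℕ.<ᵇ k)       ≡⟨ count-< k≤n ⟩
    k                                    ∎
    where open ≡-Reasoning

path-upSteps : (k≤n : k ℕ.≤ n) (w : Permutation′ n) → UpStepsAreImage w (path k≤n w)
path-upSteps {k} {n} k≤n w j = mk⇔
  (λ j∈ → w ⟨$⟩ˡ j
        , ℕ.<ᵇ⇒< _ k (subst T (sym (trans (sym (lookup-up p j)) ([]=⇒lookup j∈))) _)
        , inverseʳ w)
  (λ { (i , i<k , refl) → lookup⇒[]= j _
         (trans (lookup-up p j)
           (T⇒≡ (ℕ.<⇒<ᵇ (subst (ℕ._< k) (cong toℕ (sym (inverseˡ w))) i<k)))) })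
  where
  open import Data.Bool.Base using (T)
  p : Fin n → Bool
  p j = toℕ (w ⟨$⟩ˡ j) ℕ.<ᵇ k
  T⇒≡ : ∀ {b} → T b → b ≡ true
  T⇒≡ {true} _ = refl

path-unique : (w : Permutation′ n) (P Q : LatticePath n k) →
              UpStepsAreImage w P → UpStepsAreImage w Q → steps P ≡ steps Q
path-unique w P Q hP hQ = up-determined (steps P) (steps Q) (⊆-antisym
  (λ {j} j∈ → Equivalence.from (hQ j) (Equivalence.to (hP j) j∈))
  (λ {j} j∈ → Equivalence.from (hP j) (Equivalence.to (hQ j) j∈)))

{-# OPTIONS --safe #-}

-- Each of w, x_w and τ_P has the shape v(i) + q n ↦ g(i) + (c(i) + q) n, where
-- (v , g) = (id , w), (w , id), (w , w) respectively; c = 0 for w, and for the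
-- other two c(i) = 1 if i ≤ k and c(i) = 0 otherwise.  Comparing integers
-- lexicographically by quotient and residue, the Grassmannian condition leaves
-- only inversions indexed by pairs (i , j) with i ≤ k < j: those with w(j) < w(i)
-- for w, those with w(i) < w(j) for x_w, and all of them for τ_P.  Hence
-- ℓ(x_w) + ℓ(w) = ℓ(τ_P) = k (n - k).

module Submission where

open import Defs
open import Data.Nat.Base using (ℕ; NonTrivial; _≤_; _*_; _∸_)
open import Data.Fin.Base using (Fin)
open import Data.Fin.Permutation using (Permutation′)
open import Data.List.Base using (List; _++_; length)
open import Data.Product.Base using (_×_)
open import Relation.Binary.PropositionalEquality using (_≡_)

open import Data.Bool.Base using (Bool; true; false; if_then_else_)
import Data.Fin.Base as Fin
import Data.Fin.Properties as Fin
open import Data.Fin.Permutation as Perm using (_⟨$⟩ʳ_; _⟨$⟩ˡ_; inverseʳ; inverseˡ)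
open import Data.Integer.Base as ℤ using (ℤ; +_; 0ℤ; 1ℤ; +≤+; +<+)
import Data.Integer.Properties as ℤ
open import Algebra.Bundles using (AbelianGroup)
open import Algebra.Properties.Group (AbelianGroup.group ℤ.+-0-abelianGroup) using (∙-cancelˡ)
open import Data.Integer.Tactic.RingSolver using (solve-∀)
open import Data.List.Base using ([]; _∷_)
open import Data.List.Properties using (length-++)
import Data.Nat.Base as ℕ
import Data.Nat.Properties as ℕ
open import Data.Product.Base using (Σ-syntax; _,_; proj₁; proj₂)
open import Data.Sum.Base using (_⊎_; inj₁; inj₂)
open import Data.Sum.Function.Propositional using (_⊎-↔_)
open import Data.Vec.Base using (lookup)
open import Data.Vec.Properties using ([]=⇒lookup; lookup⇒[]=)
open import Function.Bundles using (_↔_; mk↔ₛ′; Equivalence)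
open import Function.Properties.Inverse using (↔-sym; ↔-trans)
open import Relation.Binary.Definitions using (tri<; tri≈; tri>)
open import Relation.Binary.PropositionalEquality
  using (refl; sym; trans; cong; cong₂; subst; subst₂; module ≡-Reasoning)
open import Relation.Nullary using (¬_; yes; no; does; contradiction)
open import Relation.Nullary.Decidable using (dec-true; dec-false)

private
  variable
    n k : ℕ

at : Fin n → ℤ → ℤ
at {n} i q = label i ℤ.+ q ℤ.* + n

at-0 : (i : Fin n) → at i 0ℤ ≡ label i
at-0 i = ℤ.+-identityʳ (label i)

infix 4 _≺_
_≺_ : ℤ × Fin n → ℤ × Fin n → Set
(q , i) ≺ (q′ , j) = q ℤ.< q′ ⊎ (q ≡ q′ × i Fin.< j)

at-mono : ∀ {q q′} {i j : Fin n} → (q , i) ≺ (q′ , j) → at i q ℤ.< at j q′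
at-mono {n} {q} {q′} {i} {j} (inj₁ q<q′) = begin-strict
  label i ℤ.+ q ℤ.* + n  ≤⟨ ℤ.+-monoˡ-≤ (q ℤ.* + n) (+≤+ (Fin.toℕ<n i)) ⟩
  + n ℤ.+ q ℤ.* + n      ≡⟨ ℤ.suc-* q (+ n) ⟨
  ℤ.suc q ℤ.* + n        ≤⟨ ℤ.*-monoʳ-≤-nonNeg (+ n) (ℤ.i<j⇒suc[i]≤j q<q′) ⟩
  q′ ℤ.* + n             ≡⟨ ℤ.+-identityˡ _ ⟨
  0ℤ ℤ.+ q′ ℤ.* + n      <⟨ ℤ.+-monoˡ-< (q′ ℤ.* + n) (+<+ ℕ.z<s) ⟩
  label j ℤ.+ q′ ℤ.* + n ∎
  where open ℤ.≤-Reasoning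
at-mono {n} {q} (inj₂ (refl , i<j)) = ℤ.+-monoˡ-< (q ℤ.* + n) (+<+ (ℕ.s<s i<j))

at-cancel : ∀ {q q′} {i j : Fin n} → at i q ℤ.< at j q′ → (q , i) ≺ (q′ , j)
at-cancel {q = q} {q′} {i} {j} lt with ℤ.<-cmp q q′
... | tri< q<q′ _ _ = inj₁ q<q′
... | tri> _ _ q′<q = contradiction (at-mono {i = j} {i} (inj₁ q′<q)) (ℤ.<-asym lt)
... | tri≈ _ refl _ with Fin.<-cmp i j
...   | tri< i<j _ _  = inj₂ (refl , i<j)
...   | tri≈ _ refl _ = contradiction lt (ℤ.<-irrefl refl)
...   | tri> _ _ j<i  = contradiction (at-mono {q = q} {i = j} {i} (inj₂ (refl , j<i))) (ℤ.<-asym lt)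

Pairs : (Fin n → Fin n → Set) → Set
Pairs {n} R = Σ[ (i , j) ∈ Fin n × Fin n ] R i j

Pairs-≡ : {R : Fin n → Fin n → Set} → (∀ {i j} (r r′ : R i j) → r ≡ r′) →
          ∀ {i i′ j j′} {r : R i j} {r′ : R i′ j′} → i ≡ i′ → j ≡ j′ →
          _≡_ {A = Pairs R} ((i , j) , r) ((i′ , j′) , r′)
Pairs-≡ irr refl refl = cong (_ ,_) (irr _ _)

Inversion-≡ : (f : AffinePerm n) {s t : Inversion f} →
              proj₁ (proj₁ s) ≡ proj₁ (proj₁ t) → proj₂ (proj₁ s) ≡ proj₂ (proj₁ t) → s ≡ t
Inversion-≡ f {_ , (l , u) , p , q} {_ , (l′ , u′) , p′ , q′} refl refl
  rewrite ℤ.≤-irrelevant l l′ | ℤ.≤-irrelevant u u′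
        | ℤ.<-irrelevant p p′ | ℤ.<-irrelevant q q′ = refl

Crossing : ℕ → Fin n → Fin n → Set
Crossing k i j = Fin.toℕ i ℕ.< k × k ≤ Fin.toℕ j

Crossing-irrelevant : {i j : Fin n} (r r′ : Crossing k i j) → r ≡ r′
Crossing-irrelevant (a , b) (a′ , b′) = cong₂ _,_ (ℕ.<-irrelevant a a′) (ℕ.≤-irrelevant b b′)

CrossingWith : ℕ → (Fin n → Fin n → Set) → Fin n → Fin n → Set
CrossingWith k S i j = Crossing k i j × S i j

Ascending Descending : Permutation′ n → Fin n → Fin n → Set
Ascending  w i j = w ⟨$⟩ʳ i Fin.< w ⟨$⟩ʳ j
Descending w i j = w ⟨$⟩ʳ j Fin.< w ⟨$⟩ʳ i

CrossingWith-irrelevant : {S : Fin n → Fin n → Set} → (∀ {i j} (s s′ : S i j) → s ≡ s′) →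
  ∀ {i j} (r r′ : CrossingWith k S i j) → r ≡ r′
CrossingWith-irrelevant irr (r , s) (r′ , s′) = cong₂ _,_ (Crossing-irrelevant r r′) (irr s s′)

crossings : k ≤ n → (Fin k × Fin (n ∸ k)) ↔ Pairs {n} (Crossing k)
crossings {k} {n} k≤n = mk↔ₛ′ forth back
  (λ { ((i , j) , i<k , k≤j) → Pairs-≡ (λ {i} {j} → Crossing-irrelevant {i = i} {j})
         (Fin.toℕ-injective (trans (Fin.toℕ-inject≤ _ k≤n) (Fin.toℕ-fromℕ< i<k)))
         (Fin.toℕ-injective (begin
            Fin.toℕ (Fin.fromℕ< _)            ≡⟨ Fin.toℕ-fromℕ< _ ⟩
            k ℕ.+ Fin.toℕ (Fin.fromℕ< (ℕ.∸-monoˡ-< (Fin.toℕ<n j) k≤j))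
              ≡⟨ cong (k ℕ.+_) (Fin.toℕ-fromℕ< _) ⟩
            k ℕ.+ (Fin.toℕ j ∸ k)             ≡⟨ ℕ.m+[n∸m]≡n k≤j ⟩
            Fin.toℕ j                         ∎)) })
  (λ { (i , j) → cong₂ _,_
         (Fin.toℕ-injective (trans (Fin.toℕ-fromℕ< _) (Fin.toℕ-inject≤ i k≤n)))
         (Fin.toℕ-injective (begin
            Fin.toℕ (Fin.fromℕ< _)            ≡⟨ Fin.toℕ-fromℕ< _ ⟩
            Fin.toℕ (upper j) ∸ k             ≡⟨ cong (_∸ k) (toℕ-upper j) ⟩
            k ℕ.+ Fin.toℕ j ∸ k               ≡⟨ ℕ.m+n∸m≡n k (Fin.toℕ j) ⟩
            Fin.toℕ j                         ∎)) })
  where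
  open ≡-Reasoning
  k+j<n : (j : Fin (n ∸ k)) → k ℕ.+ Fin.toℕ j ℕ.< n
  k+j<n j = subst (k ℕ.+ Fin.toℕ j ℕ.<_) (ℕ.m+[n∸m]≡n k≤n) (ℕ.+-monoʳ-< k (Fin.toℕ<n j))
  upper : Fin (n ∸ k) → Fin n
  upper j = Fin.fromℕ< (k+j<n j)
  toℕ-upper : ∀ j → Fin.toℕ (upper j) ≡ k ℕ.+ Fin.toℕ j
  toℕ-upper j = Fin.toℕ-fromℕ< (k+j<n j)
  forth : Fin k × Fin (n ∸ k) → Pairs {n} (Crossing k)
  forth (i , j) = (Fin.inject≤ i k≤n , upper j)
    , subst (ℕ._< k) (sym (Fin.toℕ-inject≤ i k≤n)) (Fin.toℕ<n i)
    , subst (k ≤_) (sym (toℕ-upper j)) (ℕ.m≤m+n k _)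
  back : Pairs {n} (Crossing k) → Fin k × Fin (n ∸ k)
  back ((i , j) , i<k , k≤j) = Fin.fromℕ< i<k , Fin.fromℕ< (ℕ.∸-monoˡ-< (Fin.toℕ<n j) k≤j)

Crossing-< : {i j : Fin n} → Crossing k i j → i Fin.< j
Crossing-< (i<k , k≤j) = ℕ.<-≤-trans i<k k≤j

⟨$⟩ʳ-injective : (w : Permutation′ n) {i j : Fin n} → w ⟨$⟩ʳ i ≡ w ⟨$⟩ʳ j → i ≡ j
⟨$⟩ʳ-injective w eq = trans (sym (inverseˡ w)) (trans (cong (w ⟨$⟩ˡ_) eq) (inverseˡ w))

crossing-cmp : (w : Permutation′ n) {i j : Fin n} → Crossing k i j →
               Ascending w i j ⊎ Descending w i j
crossing-cmp w {i} {j} r with Fin.<-cmp (w ⟨$⟩ʳ i) (w ⟨$⟩ʳ j)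
... | tri< lt _ _ = inj₁ lt
... | tri≈ _ eq _ = contradiction (cong Fin.toℕ (⟨$⟩ʳ-injective w eq))
                                  (ℕ.<⇒≢ (Crossing-< {i = i} {j} r))
... | tri> _ _ gt = inj₂ gt

crossings-split : (w : Permutation′ n) →
  (Pairs (CrossingWith k (Ascending w)) ⊎ Pairs (CrossingWith k (Descending w)))
    ↔ Pairs (Crossing k)
crossings-split {n} {k} w = mk↔ₛ′ forth back forth-back back-forth
  where
  tag : ∀ {i j} → Crossing k i j → Ascending w i j ⊎ Descending w i j →
        Pairs (CrossingWith k (Ascending w)) ⊎ Pairs (CrossingWith k (Descending w))
  tag r (inj₁ s) = inj₁ (_ , r , s)
  tag r (inj₂ s) = inj₂ (_ , r , s)
  forth : Pairs (CrossingWith k (Ascending w)) ⊎ Pairs (CrossingWith k (Descending w)) →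
          Pairs (Crossing k)
  forth (inj₁ (ij , r , _)) = ij , r
  forth (inj₂ (ij , r , _)) = ij , r
  back : Pairs (Crossing k) →
         Pairs (CrossingWith k (Ascending w)) ⊎ Pairs (CrossingWith k (Descending w))
  back (_ , r) = tag r (crossing-cmp w r)
  forth-tag : ∀ {i j} (r : Crossing k i j) s → forth (tag r s) ≡ ((i , j) , r)
  forth-tag r (inj₁ _) = refl
  forth-tag r (inj₂ _) = refl
  forth-back : ∀ p → forth (back p) ≡ p
  forth-back (_ , r) = forth-tag r (crossing-cmp w r)
  back-forth : ∀ p → back (forth p) ≡ p
  back-forth (inj₁ (_ , r , s)) with crossing-cmp w r
  ... | inj₁ s′ = cong (λ s → inj₁ (_ , r , s)) (ℕ.<-irrelevant s′ s)
  ... | inj₂ s′ = contradiction s′ (ℕ.<-asym s)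
  back-forth (inj₂ (_ , r , s)) with crossing-cmp w r
  ... | inj₁ s′ = contradiction s′ (ℕ.<-asym s)
  ... | inj₂ s′ = cong (λ s → inj₂ (_ , r , s)) (ℕ.<-irrelevant s′ s)

upShift : ℕ → Fin n → ℤ
upShift k i = if does (Fin.toℕ i ℕ.<? k) then 1ℤ else 0ℤ

upShift-< : {i : Fin n} → Fin.toℕ i ℕ.< k → upShift k i ≡ 1ℤ
upShift-< {k = k} {i = i} i<k = cong (if_then 1ℤ else 0ℤ) (dec-true (Fin.toℕ i ℕ.<? k) i<k)

upShift-≥ : {i : Fin n} → k ≤ Fin.toℕ i → upShift k i ≡ 0ℤ
upShift-≥ {k = k} {i = i} k≤i =
  cong (if_then 1ℤ else 0ℤ) (dec-false (Fin.toℕ i ℕ.<? k) (ℕ.≤⇒≯ k≤i))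

SameSide : ℕ → Fin n → Fin n → Set
SameSide k i j = (Fin.toℕ i ℕ.< k × Fin.toℕ j ℕ.< k) ⊎ (k ≤ Fin.toℕ i × k ≤ Fin.toℕ j)

Grassmannian-mono : {w : Permutation′ n} → IsGrassmannian k w →
  ∀ {i j} → SameSide k i j → i Fin.< j → w ⟨$⟩ʳ i Fin.< w ⟨$⟩ʳ j
Grassmannian-mono gr (inj₁ (_ , j<k)) i<j = proj₁ gr _ _ i<j j<k
Grassmannian-mono gr (inj₂ (k≤i , _)) i<j = proj₂ gr _ _ i<j k≤i

unshifted : ∀ {q} {a b d e : Fin n} → (0ℤ , a) ≺ (q , b) → (q , d) ≺ (0ℤ , e) →
            q ≡ 0ℤ × a Fin.< b × d Fin.< e
unshifted (inj₁ 0<q) (inj₁ q<0) = contradiction 0<q (ℤ.<-asym q<0)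
unshifted (inj₁ 0<q) (inj₂ (refl , _)) = contradiction 0<q (ℤ.<-irrefl refl)
unshifted (inj₂ (refl , _)) (inj₁ q<0) = contradiction q<0 (ℤ.<-irrefl refl)
unshifted (inj₂ (refl , a<b)) (inj₂ (_ , d<e)) = refl , a<b , d<e

≺-cancel : ∀ r {q} {d e : Fin n} → (r ℤ.+ q , d) ≺ (r , e) → (q , d) ≺ (0ℤ , e)
≺-cancel r {q} (inj₁ lt) =
  inj₁ (ℤ.≰⇒> (λ 0≤q → ℤ.<⇒≱ (subst (r ℤ.+ q ℤ.<_) (sym (ℤ.+-identityʳ r)) lt)
                             (ℤ.+-monoʳ-≤ r 0≤q)))
≺-cancel r {q} (inj₂ (eq , d<e)) =
  inj₂ (∙-cancelˡ r q 0ℤ (trans eq (sym (ℤ.+-identityʳ r))) , d<e)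

shifted : ∀ {q} {a b d e : Fin n} → (0ℤ , a) ≺ (q , b) → (0ℤ ℤ.+ q , d) ≺ (1ℤ , e) →
          (q ≡ 0ℤ × a Fin.< b) ⊎ (q ≡ 1ℤ × d Fin.< e)
shifted (inj₂ (refl , a<b)) _ = inj₁ (refl , a<b)
shifted (inj₁ (+<+ (ℕ.s≤s _))) (inj₂ (refl , d<e)) = inj₂ (refl , d<e)
shifted (inj₁ (+<+ (ℕ.s≤s _))) (inj₁ (+<+ (ℕ.s≤s ())))

¬backshifted : ∀ {q} {a b d e : Fin n} → (0ℤ , a) ≺ (q , b) → ¬ ((1ℤ ℤ.+ q , d) ≺ (0ℤ , e))
¬backshifted (inj₁ (+<+ _)) (inj₁ (+<+ ()))
¬backshifted (inj₂ (refl , _)) (inj₁ (+<+ ()))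
¬backshifted (inj₁ (+<+ _)) (inj₂ (() , _))
¬backshifted (inj₂ (refl , _)) (inj₂ (() , _))

shift-cases : ∀ k (i j : Fin n) {q} {a b d e : Fin n} →
  (0ℤ , a) ≺ (q , b) → (upShift k j ℤ.+ q , d) ≺ (upShift k i , e) →
  (SameSide k i j × a Fin.< b × d Fin.< e)
    ⊎ (Crossing k i j × ((q ≡ 0ℤ × a Fin.< b) ⊎ (q ≡ 1ℤ × d Fin.< e)))
shift-cases k i j 0≺q lt with Fin.toℕ i ℕ.<? k | Fin.toℕ j ℕ.<? k
... | yes i<k | yes j<k rewrite upShift-< {i = i} i<k | upShift-< {i = j} j<k =
  inj₁ (inj₁ (i<k , j<k) , proj₂ (unshifted 0≺q (≺-cancel 1ℤ lt)))
... | yes i<k | no j≮k  rewrite upShift-< {i = i} i<k | upShift-≥ {i = j} (ℕ.≮⇒≥ j≮k) =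
  inj₂ ((i<k , ℕ.≮⇒≥ j≮k) , shifted 0≺q lt)
... | no i≮k  | yes j<k rewrite upShift-≥ {i = i} (ℕ.≮⇒≥ i≮k) | upShift-< {i = j} j<k =
  contradiction lt (¬backshifted 0≺q)
... | no i≮k  | no j≮k
  rewrite upShift-≥ {i = i} (ℕ.≮⇒≥ i≮k) | upShift-≥ {i = j} (ℕ.≮⇒≥ j≮k) =
  inj₁ (inj₂ (ℕ.≮⇒≥ i≮k , ℕ.≮⇒≥ j≮k) , proj₂ (unshifted 0≺q (≺-cancel 0ℤ lt)))

module _ {n : ℕ} .{{_ : NonTrivial n}} where

  label-residue-window : ∀ {a} → 1ℤ ℤ.≤ a → a ℤ.≤ + n → label (residue {n} a) ≡ a
  label-residue-window {+ ℕ.suc m} _ (+≤+ m<n) = begin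
    label (residue {n} (+ ℕ.suc m))   ≡⟨ cong (λ b → label (residue {n} b)) label-i ⟨
    label (residue {n} (label i))     ≡⟨ cong label (residue-label i) ⟩
    label i                           ≡⟨ label-i ⟩
    + ℕ.suc m                         ∎
    where
    open ≡-Reasoning
    i = Fin.fromℕ< m<n
    label-i : label i ≡ + ℕ.suc m
    label-i = cong (λ r → + ℕ.suc r) (Fin.toℕ-fromℕ< m<n)
  label-residue-window {+ ℕ.zero} (+≤+ ()) _

  module _ (f : AffinePerm n) (v : Permutation′ n) (g : Fin n → Fin n) (c : Fin n → ℤ)
           (f-at : ∀ i q → to f (at (v ⟨$⟩ʳ i) q) ≡ at (g i) (c i ℤ.+ q))
    where

    private
      f-label : ∀ i → to f (label (v ⟨$⟩ʳ i)) ≡ at (g i) (c i)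
      f-label i = begin
        to f (label (v ⟨$⟩ʳ i))      ≡⟨ cong (to f) (at-0 (v ⟨$⟩ʳ i)) ⟨
        to f (at (v ⟨$⟩ʳ i) 0ℤ)      ≡⟨ f-at i 0ℤ ⟩
        at (g i) (c i ℤ.+ 0ℤ)        ≡⟨ cong (at (g i)) (ℤ.+-identityʳ (c i)) ⟩
        at (g i) (c i)               ∎
        where open ≡-Reasoning

    inversions-by-position :
      {R : Fin n → Fin n → Set} (q : Fin n → Fin n → ℤ) →
      (∀ {i j} (r r′ : R i j) → r ≡ r′) →
      (∀ {i j} → R i j → (0ℤ , v ⟨$⟩ʳ i) ≺ (q i j , v ⟨$⟩ʳ j)
                       × (c j ℤ.+ q i j , g j) ≺ (c i , g i)) →
      (∀ {i j q′} → (0ℤ , v ⟨$⟩ʳ i) ≺ (q′ , v ⟨$⟩ʳ j) → (c j ℤ.+ q′ , g j) ≺ (c i , g i) →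
                    R i j × q′ ≡ q i j) →
      Pairs R ↔ Inversion f
    inversions-by-position {R} q irr sound complete = mk↔ₛ′ forth back forth-back back-forth
      where
      pos : ℤ → Fin n
      pos a = v ⟨$⟩ˡ residue a

      at-pos : ∀ b → at (v ⟨$⟩ʳ pos b) (quotient {n} b) ≡ b
      at-pos b = trans (cong (λ r → at r (quotient {n} b)) (inverseʳ v)) (label-residue b)

      label-pos : ∀ {a} → 1ℤ ℤ.≤ a → a ℤ.≤ + n → label (v ⟨$⟩ʳ pos a) ≡ a
      label-pos l u = trans (cong label (inverseʳ v)) (label-residue-window l u)

      pos-at : ∀ j q → pos (at (v ⟨$⟩ʳ j) q) ≡ j
      pos-at j q = trans (cong (v ⟨$⟩ˡ_) (proj₁ (residue-quotient (v ⟨$⟩ʳ j) q))) (inverseˡ v)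

      pos-label : ∀ i → pos (label (v ⟨$⟩ʳ i)) ≡ i
      pos-label i = trans (cong (v ⟨$⟩ˡ_) (residue-label (v ⟨$⟩ʳ i))) (inverseˡ v)

      forth : Pairs R → Inversion f
      forth ((i , j) , r) =
          (label (v ⟨$⟩ʳ i) , at (v ⟨$⟩ʳ j) (q i j))
        , (+≤+ (ℕ.s≤s ℕ.z≤n) , +≤+ (Fin.toℕ<n _))
        , subst (ℤ._< at (v ⟨$⟩ʳ j) (q i j)) (at-0 (v ⟨$⟩ʳ i))
            (at-mono {i = v ⟨$⟩ʳ i} {v ⟨$⟩ʳ j} (proj₁ (sound r)))
        , subst₂ ℤ._<_ (sym (f-at j (q i j))) (sym (f-label i))
            (at-mono {i = g j} {g i} (proj₂ (sound r)))

      found : ∀ {a b} → 1ℤ ℤ.≤ a → a ℤ.≤ + n → a ℤ.< b → to f b ℤ.< to f a →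
              R (pos a) (pos b) × quotient {n} b ≡ q (pos a) (pos b)
      found {a} {b} l u a<b fb<fa = complete
        (at-cancel {i = v ⟨$⟩ʳ pos a} {v ⟨$⟩ʳ pos b} (subst₂ ℤ._<_
          (sym (trans (at-0 (v ⟨$⟩ʳ pos a)) (label-pos l u))) (sym (at-pos b)) a<b))
        (at-cancel {i = g (pos b)} {g (pos a)} (subst₂ ℤ._<_
          (trans (cong (to f) (sym (at-pos b))) (f-at (pos b) (quotient {n} b)))
          (trans (cong (to f) (sym (label-pos l u))) (f-label (pos a))) fb<fa))

      back : Inversion f → Pairs R
      back ((a , b) , (l , u) , a<b , fb<fa) = (pos a , pos b) , proj₁ (found l u a<b fb<fa)

      forth-back : ∀ t → forth (back t) ≡ t
      forth-back ((a , b) , (l , u) , a<b , fb<fa) = Inversion-≡ f (label-pos l u)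
        (trans (cong (at (v ⟨$⟩ʳ pos b)) (sym (proj₂ (found l u a<b fb<fa)))) (at-pos b))

      back-forth : ∀ p → back (forth p) ≡ p
      back-forth ((i , j) , r) = Pairs-≡ irr (pos-label i) (pos-at j (q i j))

  extend-at : (w : Permutation′ n) → ∀ i q → extend w (at i q) ≡ at (w ⟨$⟩ʳ i) q
  extend-at w i q = cong₂ (λ j → at (w ⟨$⟩ʳ j)) (proj₁ (residue-quotient i q))
                                                (proj₂ (residue-quotient i q))

  translation-at : (p : Fin n → Bool) → ∀ i q →
    to (translation p) (at i q) ≡ at i ((if p i then 1ℤ else 0ℤ) ℤ.+ q)
  translation-at p i q rewrite proj₁ (residue-quotient i q) with p i
  ... | true  = arith (label i) q (+ n)
    where
    arith : ∀ a q m → a ℤ.+ q ℤ.* m ℤ.+ m ≡ a ℤ.+ (1ℤ ℤ.+ q) ℤ.* m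
    arith = solve-∀
  ... | false = cong (at i) (sym (ℤ.+-identityˡ q))

  wordProduct-++ : (xs ys : List (Fin n)) →
                   wordProduct (xs ++ ys) ≈ wordProduct xs · wordProduct ys
  wordProduct-++ []       ys a = refl
  wordProduct-++ (i ∷ xs) ys a = wordProduct-++ xs ys (swap i a)

  module _ {k} (k≤n : k ≤ n) (w : Permutation′ n) (gr : IsGrassmannian k w)
           (P : LatticePath n k) (im : UpStepsAreImage w P)
    where

    x-at : ∀ i q → to (perm (x k≤n w)) (at (w ⟨$⟩ʳ i) q) ≡ at i (upShift k i ℤ.+ q)
    x-at i q = begin
      to (perm τ[ k≤n ]) (extend (Perm.flip w) (at (w ⟨$⟩ʳ i) q))
        ≡⟨ cong (to (perm τ[ k≤n ])) (extend-at (Perm.flip w) (w ⟨$⟩ʳ i) q) ⟩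
      to (perm τ[ k≤n ]) (at (w ⟨$⟩ˡ (w ⟨$⟩ʳ i)) q)
        ≡⟨ cong (λ i → to (perm τ[ k≤n ]) (at i q)) (inverseˡ w) ⟩
      to (perm τ[ k≤n ]) (at i q)  ≡⟨ translation-at (λ i → Fin.toℕ i ℕ.<ᵇ k) i q ⟩
      at i (upShift k i ℤ.+ q)     ∎
      where open ≡-Reasoning

    up-image : ∀ i → lookup (upSteps P) (w ⟨$⟩ʳ i) ≡ does (Fin.toℕ i ℕ.<? k)
    up-image i with Fin.toℕ i ℕ.<? k
    ... | yes i<k = trans ([]=⇒lookup (Equivalence.from (im (w ⟨$⟩ʳ i)) (i , i<k , refl)))
                          (sym (dec-true (Fin.toℕ i ℕ.<? k) i<k))
    ... | no i≮k with lookup (upSteps P) (w ⟨$⟩ʳ i) in eq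
    ...   | false = sym (dec-false (Fin.toℕ i ℕ.<? k) i≮k)
    ...   | true with Equivalence.to (im (w ⟨$⟩ʳ i)) (lookup⇒[]= _ (upSteps P) eq)
    ...     | i′ , i′<k , eq′ =
      contradiction (subst (λ i → Fin.toℕ i ℕ.< k) (⟨$⟩ʳ-injective w eq′) i′<k) i≮k

    τ-at : ∀ i q → to (perm (τ P)) (at (w ⟨$⟩ʳ i) q) ≡ at (w ⟨$⟩ʳ i) (upShift k i ℤ.+ q)
    τ-at i q = trans (translation-at (lookup (upSteps P)) (w ⟨$⟩ʳ i) q)
      (cong (λ b → at (w ⟨$⟩ʳ i) ((if b then 1ℤ else 0ℤ) ℤ.+ q)) (up-image i))

    x·w≈τ : perm (x k≤n w) · perm (finite w) ≈ perm (τ P)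
    x·w≈τ a = subst (λ b → to (perm (x k≤n w) · perm (finite w)) b ≡ to (perm (τ P)) b)
      (trans (cong (λ r → at r q) (inverseʳ w)) (label-residue a))
      (begin
        extend w (to (perm (x k≤n w)) (at (w ⟨$⟩ʳ i) q)) ≡⟨ cong (extend w) (x-at i q) ⟩
        extend w (at i (upShift k i ℤ.+ q))               ≡⟨ extend-at w i (upShift k i ℤ.+ q) ⟩
        at (w ⟨$⟩ʳ i) (upShift k i ℤ.+ q)                 ≡⟨ τ-at i q ⟨
        to (perm (τ P)) (at (w ⟨$⟩ʳ i) q)                 ∎)
      where
      open ≡-Reasoning
      i = w ⟨$⟩ˡ residue a
      q = quotient {n} a

    w-inversions : Pairs (CrossingWith k (Descending w)) ↔ Inversion (perm (finite w))
    w-inversions = inversions-by-position (perm (finite w)) Perm.id (w ⟨$⟩ʳ_) (λ _ → 0ℤ)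
      (λ i q → trans (extend-at w i q) (cong (at (w ⟨$⟩ʳ i)) (sym (ℤ.+-identityˡ q))))
      (λ _ _ → 0ℤ) (CrossingWith-irrelevant {S = Descending w} ℕ.<-irrelevant)
      (λ {i} {j} (r , desc) → inj₂ (refl , Crossing-< {i = i} {j} r) , inj₂ (refl , desc))
      complete
      where
      complete : ∀ {i j q} → (0ℤ , i) ≺ (q , j) → (0ℤ ℤ.+ q , w ⟨$⟩ʳ j) ≺ (0ℤ , w ⟨$⟩ʳ i) →
                 CrossingWith k (Descending w) i j × q ≡ 0ℤ
      complete {i} {j} 0≺q lt with unshifted 0≺q (≺-cancel 0ℤ lt)
      ... | q≡0 , i<j , desc =
        ((ℕ.≰⇒> (λ k≤i → ℕ.<-asym desc (proj₂ gr i j i<j k≤i))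
         , ℕ.≮⇒≥ (λ j<k → ℕ.<-asym desc (proj₁ gr i j i<j j<k))) , desc) , q≡0

    x-inversions : Pairs (CrossingWith k (Ascending w)) ↔ Inversion (perm (x k≤n w))
    x-inversions = inversions-by-position (perm (x k≤n w)) w (λ i → i) (upShift k) x-at
      (λ _ _ → 0ℤ) (CrossingWith-irrelevant {S = Ascending w} ℕ.<-irrelevant) sound complete
      where
      sound : ∀ {i j} → CrossingWith k (Ascending w) i j →
              (0ℤ , w ⟨$⟩ʳ i) ≺ (0ℤ , w ⟨$⟩ʳ j) × (upShift k j ℤ.+ 0ℤ , j) ≺ (upShift k i , i)
      sound {i} {j} ((i<k , k≤j) , asc)
        rewrite upShift-< {i = i} i<k | upShift-≥ {i = j} k≤j =
        inj₂ (refl , asc) , inj₁ (+<+ ℕ.z<s)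
      complete : ∀ {i j q} → (0ℤ , w ⟨$⟩ʳ i) ≺ (q , w ⟨$⟩ʳ j) →
                 (upShift k j ℤ.+ q , j) ≺ (upShift k i , i) →
                 CrossingWith k (Ascending w) i j × q ≡ 0ℤ
      complete {i} {j} 0≺q lt with shift-cases k i j 0≺q lt
      ... | inj₁ (same , asc , j<i) =
        contradiction (Grassmannian-mono {w = w} gr (swap-sides same) j<i) (ℕ.<-asym asc)
        where
        swap-sides : SameSide k i j → SameSide k j i
        swap-sides (inj₁ (p , q)) = inj₁ (q , p)
        swap-sides (inj₂ (p , q)) = inj₂ (q , p)
      ... | inj₂ (r , inj₁ (q≡0 , asc)) = (r , asc) , q≡0
      ... | inj₂ (r , inj₂ (_ , j<i)) = contradiction (Crossing-< {i = i} {j} r) (ℕ.<-asym j<i)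

    τ-inversions : Pairs (Crossing k) ↔ Inversion (perm (τ P))
    τ-inversions = inversions-by-position (perm (τ P)) w (w ⟨$⟩ʳ_) (upShift k) τ-at
      wrap (λ {i} {j} → Crossing-irrelevant {i = i} {j}) (λ {i} {j} → sound {i} {j}) complete
      where
      wrap : Fin n → Fin n → ℤ
      wrap i j = if does (w ⟨$⟩ʳ j Fin.<? w ⟨$⟩ʳ i) then 1ℤ else 0ℤ
      wrap-desc : ∀ {i j} → Descending w i j → wrap i j ≡ 1ℤ
      wrap-desc {i} {j} desc =
        cong (if_then 1ℤ else 0ℤ) (dec-true (w ⟨$⟩ʳ j Fin.<? w ⟨$⟩ʳ i) desc)
      wrap-asc : ∀ {i j} → Ascending w i j → wrap i j ≡ 0ℤ
      wrap-asc {i} {j} asc =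
        cong (if_then 1ℤ else 0ℤ) (dec-false (w ⟨$⟩ʳ j Fin.<? w ⟨$⟩ʳ i) (ℕ.<-asym asc))
      sound : ∀ {i j} → Crossing k i j →
              (0ℤ , w ⟨$⟩ʳ i) ≺ (wrap i j , w ⟨$⟩ʳ j)
                × (upShift k j ℤ.+ wrap i j , w ⟨$⟩ʳ j) ≺ (upShift k i , w ⟨$⟩ʳ i)
      sound {i} {j} (i<k , k≤j)
        rewrite upShift-< {i = i} i<k | upShift-≥ {i = j} k≤j
        with crossing-cmp {k = k} w {i} {j} (i<k , k≤j)
      ... | inj₁ asc  rewrite wrap-asc {i} {j} asc =
        inj₂ (refl , asc) , inj₁ (+<+ ℕ.z<s)
      ... | inj₂ desc rewrite wrap-desc {i} {j} desc =
        inj₁ (+<+ ℕ.z<s) , inj₂ (refl , desc)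
      complete : ∀ {i j q} → (0ℤ , w ⟨$⟩ʳ i) ≺ (q , w ⟨$⟩ʳ j) →
                 (upShift k j ℤ.+ q , w ⟨$⟩ʳ j) ≺ (upShift k i , w ⟨$⟩ʳ i) →
                 Crossing k i j × q ≡ wrap i j
      complete {i} {j} 0≺q lt with shift-cases k i j 0≺q lt
      ... | inj₁ (_ , asc , desc) = contradiction asc (ℕ.<-asym desc)
      ... | inj₂ (r , inj₁ (q≡0 , asc)) = r , trans q≡0 (sym (wrap-asc {i} {j} asc))
      ... | inj₂ (r , inj₂ (q≡1 , desc)) = r , trans q≡1 (sym (wrap-desc {i} {j} desc))

lemma3p11 : ∀ (n k : ℕ) .{{_ : NonTrivial n}} (k≤n : k ≤ n) (w : Permutation′ n) →
    IsGrassmannian k w →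
    (P : LatticePath n k) → UpStepsAreImage w P →
    (𝐱 𝐰 : List (Fin n)) →
    IsReducedWord (x k≤n w) 𝐱 → IsReducedWord (finite w) 𝐰 →
    perm (x k≤n w) · perm (finite w) ≈ perm (τ P)
    × IsReducedWord (τ P) (𝐱 ++ 𝐰)
    × length (𝐱 ++ 𝐰) ≡ k * (n ∸ k)
lemma3p11 n k k≤n w gr P im 𝐱 𝐰 (𝐱≈x , |𝐱|) (𝐰≈w , |𝐰|) =
  x·w≈τ k≤n w gr P im , (product , subst (HasLength (perm (τ P))) (sym (length-++ 𝐱)) |τ|) , total
  where
  product : wordProduct (𝐱 ++ 𝐰) ≈ (Λ ⁻¹) ^ k · perm (τ P)
  product a = begin
    to (wordProduct (𝐱 ++ 𝐰)) a                           ≡⟨ wordProduct-++ 𝐱 𝐰 a ⟩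
    to (wordProduct 𝐰) (to (wordProduct 𝐱) a)              ≡⟨ 𝐰≈w _ ⟩
    extend w (to (wordProduct 𝐱) a)                        ≡⟨ cong (extend w) (𝐱≈x a) ⟩
    extend w (to (perm (x k≤n w)) (to ((Λ ⁻¹) ^ k) a))     ≡⟨ x·w≈τ k≤n w gr P im _ ⟩
    to (perm (τ P)) (to ((Λ ⁻¹) ^ k) a)                    ∎
    where open ≡-Reasoning

  |𝐱|+|𝐰| : Fin (length 𝐱 ℕ.+ length 𝐰) ↔ Pairs (Crossing k)
  |𝐱|+|𝐰| = ↔-trans Fin.+↔⊎ (↔-trans
    (↔-trans |𝐱| (↔-sym (x-inversions k≤n w gr P im))
      ⊎-↔ ↔-trans |𝐰| (↔-sym (w-inversions k≤n w gr P im)))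
    (crossings-split w))

  |τ| : HasLength (perm (τ P)) (length 𝐱 ℕ.+ length 𝐰)
  |τ| = ↔-trans |𝐱|+|𝐰| (τ-inversions k≤n w gr P im)

  total : length (𝐱 ++ 𝐰) ≡ k * (n ∸ k)
  total = trans (length-++ 𝐱)
    (Perm.↔⇒≡ (↔-trans |𝐱|+|𝐰| (↔-sym (↔-trans Fin.*↔× (crossings k≤n)))))
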